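{- For any twin-free graph $G$ of order $n$ and any integer $m\ge3$, $$\gamma^{\rm ID}(G\Box P_m) \le \min\left\{m\,\gamma^{\rm ID}(G),\; m\,\gamma(G) + \left\lceil \frac{m}{3}\right\rceil(n - \gamma(G))\right\}.$$
   Context: All graphs are finite, simple and undirected. $N[x]$ denotes the closed neighborhood of a vertex $x$; a graph is twin-free if no two distinct vertices have the same closed neighborhood. A set $D\subseteq V(F)$ is a dominating set of $F$ if $N[x]\cap D\neq\emptyset$ for every vertex $x$; $\gamma(F)$ is the minimum cardinality of a dominating set. An identifying code (ID code) of $F$ is a dominating set $C$ such that $N[x]\cap C\neq N[y]\cap C$ for all distinct vertices $x,y$; $\gamma^{\rm ID}(F)$ is the minimum cardinality of an ID code of $F$. $P_m$ is the path on $m$ vertices and $\Box$ denotes the Cartesian product of graphs. -}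

module Defs where

open import Level using (0ℓ)
open import Data.Fin using (Fin; toℕ)
import Data.Fin.Properties as Fin
open import Data.Fin.Subset using (Subset; ∣_∣; ⊤) renaming (_∈_ to _∈ₛ_)
open import Data.Fin.Subset.Properties using (_∈?_; ∈⊤; anySubset?)
open import Data.Nat using (ℕ; suc; _+_; _*_; _≤_; _<_; _/_)
import Data.Nat.Properties as ℕ
open import Data.Nat.Induction using (<-wellFounded)
open import Data.Product using (_×_; _,_; proj₁; proj₂; ∃; ∃-syntax)
open import Data.Product.Function.NonDependent.Propositional using (_×-↔_)
open import Data.Sum using (_⊎_; inj₁; inj₂; [_,_]′)
import Data.Sum as Sum
open import Function using (_↔_; _∘_)
open import Function.Bundles using (Inverse)
open import Function.Construct.Composition using (_↔-∘_)
open import Function.Construct.Identity using (↔-id)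
open import Function.Construct.Symmetry using (↔-sym)
open import Function.Properties.Inverse using (↔⇒↣)
open import Induction.WellFounded using (Acc; acc)
open import Relation.Binary using (Rel; Symmetric; DecidableEquality)
import Relation.Binary as B
open import Relation.Binary.PropositionalEquality using (_≡_; _≢_; refl; sym; subst)
open import Relation.Nullary using (¬_; Dec; yes; no)
open import Relation.Nullary.Decidable
  using (_×-dec_; _⊎-dec_; _→-dec_; ¬?; map′; via-injection)
open import Relation.Unary using (Pred; Decidable; _∩_; _≐_; Satisfiable)
open import Relation.Unary.Properties using (_∩?_)

⌈_/3⌉ : ℕ → ℕ
⌈ m /3⌉ = (m + 2) / 3

IsMinCard : ∀ {n ℓ} → Pred (Subset n) ℓ → ℕ → Set ℓ
IsMinCard P k = (∃[ S ] P S × ∣ S ∣ ≡ k) × (∀ S → P S → k ≤ ∣ S ∣)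

minCard : ∀ {n ℓ} {P : Pred (Subset n) ℓ} → Decidable P → ∃ P → ∃ (IsMinCard P)
minCard {P = P} P? (S₀ , p₀) = search S₀ p₀ (<-wellFounded ∣ S₀ ∣)
  where
  search : ∀ S → P S → Acc _<_ ∣ S ∣ → ∃ (IsMinCard P)
  search S p (acc rs) with anySubset? (λ T → P? T ×-dec (∣ T ∣ ℕ.<? ∣ S ∣))
  ... | yes (T , q , T<S) = search T q (rs T<S)
  ... | no  ¬smaller      =
    ∣ S ∣ , (S , p , refl) , λ T q → ℕ.≮⇒≥ λ T<S → ¬smaller (T , q , T<S)

-- `_~?_` expresses that the graph is given as finite data; it holds
-- automatically in classical mathematics.
record Graph : Set₁ where
  infix 4 _~_ _~?_
  field
    Vertex : Set
    order  : ℕ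
    enum   : Vertex ↔ Fin order
    _~_    : Rel Vertex 0ℓ
    _~?_   : B.Decidable _~_
    ~-sym  : Symmetric _~_
    ~-irr  : ∀ {x} → ¬ (x ~ x)

  index : Vertex → Fin order
  index = Inverse.to enum

  vertex : Fin order → Vertex
  vertex = Inverse.from enum

  _≟_ : DecidableEquality Vertex
  _≟_ = via-injection (↔⇒↣ enum) Fin._≟_

  N[_] : Vertex → Pred Vertex 0ℓ
  N[ x ] y = y ≡ x ⊎ x ~ y

  N? : ∀ x → Decidable N[ x ]
  N? x y = (y ≟ x) ⊎-dec (x ~? y)

  -- Vertex sets are subsets of Fin order, transported along `enum`, so
  -- that their cardinality is `∣_∣` of Data.Fin.Subset.
  VertexSet : Set
  VertexSet = Subset order

  ⟦_⟧ : VertexSet → Pred Vertex 0ℓ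
  ⟦ S ⟧ x = index x ∈ₛ S

  ⟦_⟧? : ∀ S → Decidable ⟦ S ⟧
  ⟦ S ⟧? x = index x ∈? S

  TwinFree : Set
  TwinFree = ∀ x y → x ≢ y → ¬ (N[ x ] ≐ N[ y ])

  Dominating : Pred VertexSet 0ℓ
  Dominating D = ∀ x → Satisfiable (N[ x ] ∩ ⟦ D ⟧)

  IdentifyingCode : Pred VertexSet 0ℓ
  IdentifyingCode C =
    Dominating C × (∀ x y → x ≢ y → ¬ (N[ x ] ∩ ⟦ C ⟧ ≐ N[ y ] ∩ ⟦ C ⟧))

  module _ {ℓ} {P : Pred Vertex ℓ} (P? : Decidable P) where

    private
      back : ∀ x → P (vertex (index x)) → P x
      back x = subst P (Inverse.strictlyInverseʳ enum x)

    anyVertex? : Dec (Satisfiable P)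
    anyVertex? = map′ (λ (i , p) → vertex i , p)
                      (λ (x , p) → index x ,
                        subst P (sym (Inverse.strictlyInverseʳ enum x)) p)
                      (Fin.any? (P? ∘ vertex))

    allVertices? : Dec (∀ x → P x)
    allVertices? = map′ (λ f x → back x (f (index x)))
                        (λ f i → f (vertex i))
                        (Fin.all? (P? ∘ vertex))

  ≐? : ∀ {ℓ₁ ℓ₂} {P : Pred Vertex ℓ₁} {Q : Pred Vertex ℓ₂} →
       Decidable P → Decidable Q → Dec (P ≐ Q)
  ≐? P? Q? =
    map′ (λ (f , g) → (λ {x} → f x) , (λ {x} → g x))
         (λ (f , g) → (λ x → f {x}) , (λ x → g {x}))
         (allVertices? (λ x → P? x →-dec Q? x) ×-dec
          allVertices? (λ x → Q? x →-dec P? x))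

  dominating? : Decidable Dominating
  dominating? D = allVertices? λ x → anyVertex? (N? x ∩? ⟦ D ⟧?)

  identifyingCode? : Decidable IdentifyingCode
  identifyingCode? C =
    dominating? C ×-dec
    allVertices? λ x → allVertices? λ y →
      ¬? (x ≟ y) →-dec ¬? (≐? (N? x ∩? ⟦ C ⟧?) (N? y ∩? ⟦ C ⟧?))

  ⊤-dominating : Dominating ⊤
  ⊤-dominating x = x , inj₁ refl , ∈⊤

  ⊤-identifying : TwinFree → IdentifyingCode ⊤
  ⊤-identifying tf = ⊤-dominating , λ x y x≢y (f , g) →
    tf x y x≢y ( (λ z∈ → proj₁ (f (z∈ , ∈⊤)))
               , (λ z∈ → proj₁ (g (z∈ , ∈⊤))))

  γ-min : ∃ (IsMinCard Dominating)
  γ-min = minCard dominating? (⊤ , ⊤-dominating)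

  γID-min : TwinFree → ∃ (IsMinCard IdentifyingCode)
  γID-min tf = minCard identifyingCode? (⊤ , ⊤-identifying tf)

open Graph public
  using (Vertex; order; TwinFree; Dominating; IdentifyingCode; γ-min; γID-min)

γ : Graph → ℕ
γ F = proj₁ (γ-min F)

-- Identifying codes exist exactly in twin-free graphs, hence the extra
-- argument; the value does not depend on it, by the uniqueness of minima.
γID : (F : Graph) → TwinFree F → ℕ
γID F tf = proj₁ (γID-min F tf)

P : ℕ → Graph
P m = record
  { Vertex = Fin m
  ; order  = m
  ; enum   = ↔-id (Fin m)
  ; _~_    = λ i j → toℕ j ≡ suc (toℕ i) ⊎ toℕ i ≡ suc (toℕ j)
  ; _~?_   = λ i j → (toℕ j ℕ.≟ suc (toℕ i)) ⊎-dec (toℕ i ℕ.≟ suc (toℕ j))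
  ; ~-sym  = Sum.swap
  ; ~-irr  = [ ℕ.1+n≢n ∘ sym , ℕ.1+n≢n ∘ sym ]′
  }

infixr 7 _□_

_□_ : Graph → Graph → Graph
G □ H = record
  { Vertex = G.Vertex × H.Vertex
  ; order  = G.order * H.order
  ; enum   = ↔-sym Fin.*↔× ↔-∘ (G.enum ×-↔ H.enum)
  ; _~_    = λ (x , u) (y , v) → (x ≡ y × u H.~ v) ⊎ (u ≡ v × x G.~ y)
  ; _~?_   = λ (x , u) (y , v) →
               ((x G.≟ y) ×-dec (u H.~? v)) ⊎-dec ((u H.≟ v) ×-dec (x G.~? y))
  ; ~-sym  = Sum.map (λ (p , q) → sym p , H.~-sym q)
                     (λ (p , q) → sym p , G.~-sym q)
  ; ~-irr  = [ H.~-irr ∘ proj₂ , G.~-irr ∘ proj₂ ]′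
  }
  where
  module G = Graph G
  module H = Graph H

{-# OPTIONS --safe #-}

-- For a dominating set D of G and a set S of vertices of a twin-free graph H,
-- take the code (D × V(H)) ∪ (V(G) × S) in G □ H. Vertices (x , u) and (y , v)
-- in different layers are always separated: a vertex of N[x] ∩ D, placed in
-- layer u, can be adjacent to (y , v) only if it is y, so that an equality of
-- traces forces x = y ∈ D, and then N[u] = N[v]. Vertices in the same layer are
-- separated if D is an identifying code of G, and also if G is twin-free and S
-- dominates H: a layer in S shows the whole of N[x], and any other layer is
-- adjacent to a layer in S, where (x , u) sees only its own copy. The first bound
-- is the case S = ∅, the second takes for S a minimum dominating set of the path.
module Submission where

open import Defs
open import Data.Nat using (ℕ; _+_; _*_; _∸_; _≤_; _⊓_)
open import Data.Product using (Σ-syntax)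

open import Data.Bool using (if_then_else_)
open import Data.Fin using (Fin; zero; suc; toℕ; inject₁; combine)
open import Data.Fin.Properties using (toℕ-inject₁; toℕ-injective)
open import Data.Fin.Subset
  using (Subset; Side; inside; outside; ⊤; ⊥; ∁; ∣_∣) renaming (_∈_ to _∈ₛ_)
open import Data.Fin.Subset.Properties using (∣⊤∣≡n; ∣⊥∣≡0; ∣∁p∣≡n∸∣p∣)
open import Data.Nat using (zero; suc; s≤s; z≤n)
open import Data.Nat.DivMod using (m/n≡1+[m∸n]/n)
import Data.Nat.Properties as ℕ
open import Data.Nat.Solver using (module +-*-Solver)
open import Data.Product using (_×_; _,_; proj₁; proj₂; ∃-syntax)
open import Data.Sum using (_⊎_; inj₁; inj₂)
import Data.Sum as Sum
open import Data.Vec using ([]; _∷_; _++_; concat; map; lookup; here; there)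
open import Data.Vec.Properties
  using (lookup-concat; lookup-map; lookup-replicate; lookup⇒[]=; []=⇒lookup)
open import Function using (_∘_)
open import Relation.Binary.PropositionalEquality
  using (_≡_; _≢_; refl; sym; trans; cong; cong₂; subst; module ≡-Reasoning)
open import Relation.Nullary using (¬_; yes; no; contradiction)
open import Relation.Unary using (_⊆_; _∩_; _≐_)

open Graph using (N[_]; ⟦_⟧; _≟_; ~-irr)

∣++∣ : ∀ {m n} (p : Subset m) (q : Subset n) → ∣ p ++ q ∣ ≡ ∣ p ∣ + ∣ q ∣
∣++∣ []            q = refl
∣++∣ (inside  ∷ p) q = cong suc (∣++∣ p q)
∣++∣ (outside ∷ p) q = ∣++∣ p q

-- The slice of the code over one vertex of `G`, with `b` telling whether that vertex lies in `D`.
row : ∀ {m} → Subset m → Side → Subset m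
row S b = if b then ⊤ else S

-- (D × ⊤) ∪ (⊤ × S), under the identification of Fin n × Fin m with Fin (n * m).
cross : ∀ {n m} → Subset n → Subset m → Subset (n * m)
cross D S = concat (map (row S) D)

lookup-cross : ∀ {n m} (D : Subset n) (S : Subset m) i j →
  lookup (cross D S) (combine i j) ≡ lookup (row S (lookup D i)) j
lookup-cross D S i j = trans (lookup-concat (map (row S) D) i j)
  (cong (λ p → lookup p j) (lookup-map i (row S) D))

∈-crossˡ : ∀ {n m} (D : Subset n) (S : Subset m) {i} j →
  i ∈ₛ D → combine i j ∈ₛ cross D S
∈-crossˡ D S {i} j i∈D = lookup⇒[]= _ _ (trans (lookup-cross D S i j)
  (trans (cong (λ b → lookup (row S b) j) ([]=⇒lookup i∈D))
         (lookup-replicate j inside)))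

∈-crossʳ : ∀ {n m} (D : Subset n) (S : Subset m) i {j} →
  j ∈ₛ S → combine i j ∈ₛ cross D S
∈-crossʳ D S i {j} j∈S =
  lookup⇒[]= _ _ (trans (lookup-cross D S i j) (in-row (lookup D i)))
  where
  in-row : ∀ b → lookup (row S b) j ≡ inside
  in-row inside  = lookup-replicate j inside
  in-row outside = []=⇒lookup j∈S

-- A vertex of `D` contributes a full row, any other vertex a copy of `S`. Counting with `∁ D` keeps
-- truncated subtraction out of the induction.
∣cross∣-∁ : ∀ {n m} (D : Subset n) (S : Subset m) →
  ∣ cross D S ∣ ≡ m * ∣ D ∣ + ∣ S ∣ * ∣ ∁ D ∣
∣cross∣-∁ {m = m} [] S = sym (cong₂ _+_ (ℕ.*-zeroʳ m) (ℕ.*-zeroʳ ∣ S ∣))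
∣cross∣-∁ {m = m} (inside ∷ D) S = begin
  ∣ ⊤ {m} ++ cross D S ∣                    ≡⟨ ∣++∣ (⊤ {m}) (cross D S) ⟩
  ∣ ⊤ {m} ∣ + ∣ cross D S ∣                 ≡⟨ cong₂ _+_ (∣⊤∣≡n m) (∣cross∣-∁ D S) ⟩
  m + (m * ∣ D ∣ + ∣ S ∣ * ∣ ∁ D ∣)         ≡⟨ solve 4 (λ m d s c →
    m :+ (m :* d :+ s :* c) := m :* (con 1 :+ d) :+ s :* c) refl
    m (∣ D ∣) (∣ S ∣) (∣ ∁ D ∣) ⟩
  m * suc ∣ D ∣ + ∣ S ∣ * ∣ ∁ D ∣           ∎
  where open ≡-Reasoning; open +-*-Solver
∣cross∣-∁ {m = m} (outside ∷ D) S = begin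
  ∣ S ++ cross D S ∣                        ≡⟨ ∣++∣ S (cross D S) ⟩
  ∣ S ∣ + ∣ cross D S ∣                     ≡⟨ cong (∣ S ∣ +_) (∣cross∣-∁ D S) ⟩
  ∣ S ∣ + (m * ∣ D ∣ + ∣ S ∣ * ∣ ∁ D ∣)     ≡⟨ solve 4 (λ m d s c →
    s :+ (m :* d :+ s :* c) := m :* d :+ s :* (con 1 :+ c)) refl
    m (∣ D ∣) (∣ S ∣) (∣ ∁ D ∣) ⟩
  m * ∣ D ∣ + ∣ S ∣ * suc ∣ ∁ D ∣           ∎
  where open ≡-Reasoning; open +-*-Solver

∣cross∣ : ∀ {n m} (D : Subset n) (S : Subset m) →
  ∣ cross D S ∣ ≡ m * ∣ D ∣ + ∣ S ∣ * (n ∸ ∣ D ∣)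
∣cross∣ {m = m} D S =
  trans (∣cross∣-∁ D S) (cong (λ k → m * ∣ D ∣ + ∣ S ∣ * k) (∣∁p∣≡n∸∣p∣ D))

-- Twins have the same trace on every set. A code built for the product thus also supplies the
-- twin-freeness that `γID` asks for.
identifying⇒twinFree : ∀ F {C} → IdentifyingCode F C → TwinFree F
identifying⇒twinFree F (_ , separating) x y x≢y (f , g) =
  separating x y x≢y ((λ (p , c) → f p , c) , (λ (p , c) → g p , c))

γID≤ : ∀ F (tf : TwinFree F) {C} → IdentifyingCode F C → γID F tf ≤ ∣ C ∣
γID≤ F tf = proj₂ (proj₂ (γID-min F tf)) _

module _ (G H : Graph) where

  same-layer⁺ : ∀ {x z} {u} → N[_] G x z → N[_] (G □ H) (x , u) (z , u)
  same-layer⁺ (inj₁ refl) = inj₁ refl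
  same-layer⁺ (inj₂ x~z)  = inj₂ (inj₂ (refl , x~z))

  same-layer⁻ : ∀ {x z} {u} → N[_] (G □ H) (x , u) (z , u) → N[_] G x z
  same-layer⁻ (inj₁ refl)             = inj₁ refl
  same-layer⁻ (inj₂ (inj₁ (_ , u~u))) = contradiction u~u (~-irr H)
  same-layer⁻ (inj₂ (inj₂ (_ , x~z))) = inj₂ x~z

  same-column⁺ : ∀ {x} {u w} → N[_] H u w → N[_] (G □ H) (x , u) (x , w)
  same-column⁺ (inj₁ refl) = inj₁ refl
  same-column⁺ (inj₂ u~w)  = inj₂ (inj₁ (refl , u~w))

  same-column⁻ : ∀ {x} {u w} → N[_] (G □ H) (x , u) (x , w) → N[_] H u w
  same-column⁻ (inj₁ refl)             = inj₁ refl
  same-column⁻ (inj₂ (inj₁ (_ , u~w))) = inj₂ u~w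
  same-column⁻ (inj₂ (inj₂ (_ , x~x))) = contradiction x~x (~-irr G)

  -- An edge of the product moves in one coordinate only.
  other-layer : ∀ {x z} {u w} → u ≢ w → N[_] (G □ H) (x , u) (z , w) → z ≡ x
  other-layer u≢w (inj₁ refl)             = refl
  other-layer u≢w (inj₂ (inj₁ (x≡z , _))) = sym x≡z
  other-layer u≢w (inj₂ (inj₂ (u≡w , _))) = contradiction u≡w u≢w

  module _ (D : Graph.VertexSet G) (S : Graph.VertexSet H) where

    private
      C = cross D S

      module _ {x y u v}
        (sub : N[_] (G □ H) (x , u) ∩ ⟦_⟧ (G □ H) C ⊆ N[_] (G □ H) (y , v) ∩ ⟦_⟧ (G □ H) C)
        where

        -- `D` contributes whole columns to the code and `S` whole layers, so one coordinate
        -- suffices to recognise a codeword.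
        via-D : ∀ {z w} → ⟦_⟧ G D z →
          N[_] (G □ H) (x , u) (z , w) → N[_] (G □ H) (y , v) (z , w)
        via-D z∈D p = proj₁ (sub (p , ∈-crossˡ D S _ z∈D))

        via-S : ∀ {z w} → ⟦_⟧ H S w →
          N[_] (G □ H) (x , u) (z , w) → N[_] (G □ H) (y , v) (z , w)
        via-S w∈S p = proj₁ (sub (p , ∈-crossʳ D S _ w∈S))

    cross-separates-layers : TwinFree H → Dominating G D → ∀ x y u v → u ≢ v →
      ¬ (N[_] (G □ H) (x , u) ∩ ⟦_⟧ (G □ H) C ≐ N[_] (G □ H) (y , v) ∩ ⟦_⟧ (G □ H) C)
    cross-separates-layers tfH dom x y u v u≢v (f , g)
      with z , x~z , z∈D ← dom x
         | z′ , y~z′ , z′∈D ← dom y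
      -- The dominators of x and y, placed in layers u and v, must be seen from the opposite layer:
      -- hence z = y and z′ = x, and both x and y lie in `D`.
      with refl ← other-layer (u≢v ∘ sym) (via-D f z∈D (same-layer⁺ x~z))
         | refl ← other-layer u≢v (via-D g z′∈D (same-layer⁺ y~z′))
      -- Now (x , u) is itself a codeword seen by (y , v), so x = y. The whole column over this
      -- vertex is in the code and carries N[u] and N[v] in full.
      with refl ← other-layer (u≢v ∘ sym) (via-D f z′∈D (inj₁ refl))
      = tfH u v u≢v
          ( (λ p → same-column⁻ (via-D f z∈D (same-column⁺ p)))
          , (λ p → same-column⁻ (via-D g z∈D (same-column⁺ p))))

    -- The alternatives correspond to the two bounds; the first allows any `S`, in particular the
    -- empty set.
    cross-separates-columns : IdentifyingCode G D ⊎ (TwinFree G × Dominating H S) →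
      ∀ x y u → x ≢ y →
      ¬ (N[_] (G □ H) (x , u) ∩ ⟦_⟧ (G □ H) C ≐ N[_] (G □ H) (y , u) ∩ ⟦_⟧ (G □ H) C)
    cross-separates-columns (inj₁ (_ , separating)) x y u x≢y (f , g) =
      separating x y x≢y
        ( (λ (p , z∈D) → same-layer⁻ (via-D f z∈D (same-layer⁺ p)) , z∈D)
        , (λ (p , z∈D) → same-layer⁻ (via-D g z∈D (same-layer⁺ p)) , z∈D))
    cross-separates-columns (inj₂ (tfG , domS)) x y u x≢y (f , g)
      with w , u~w , w∈S ← domS u
      with _≟_ H u w
    -- The codeword (x , w) lies off layer u, and in layer w the vertex (y , u) sees only (y , w).
    ... | no u≢w =
      x≢y (other-layer u≢w (via-S f w∈S (same-column⁺ u~w)))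
    ... | yes refl = tfG x y x≢y
      ( (λ p → same-layer⁻ (via-S f w∈S (same-layer⁺ p)))
      , (λ p → same-layer⁻ (via-S g w∈S (same-layer⁺ p))))

    cross-identifying : TwinFree H → Dominating G D →
      IdentifyingCode G D ⊎ (TwinFree G × Dominating H S) → IdentifyingCode (G □ H) C
    cross-identifying tfH dom cases = dominating , separating
      where
      dominating : Dominating (G □ H) C
      dominating (x , u) with z , x~z , z∈D ← dom x =
        (z , u) , same-layer⁺ x~z , ∈-crossˡ D S _ z∈D

      separating : ∀ a b → a ≢ b →
        ¬ (N[_] (G □ H) a ∩ ⟦_⟧ (G □ H) C ≐ N[_] (G □ H) b ∩ ⟦_⟧ (G □ H) C)
      separating (x , u) (y , v) a≢b with _≟_ H u v
      ... | yes refl = cross-separates-columns cases x y u (a≢b ∘ cong (_, u))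
      ... | no u≢v   = cross-separates-layers tfH dom x y u v u≢v

-- The predecessor of suc i lies in N[ suc i ], and every element of N[ suc j ]
-- is at least the predecessor of suc j.
suc-N⊆⇒≤ : ∀ {m} (i j : Fin m) →
  N[_] (P (suc m)) (suc i) ⊆ N[_] (P (suc m)) (suc j) → toℕ j ≤ toℕ i
suc-N⊆⇒≤ {m} i j sub =
  subst (toℕ j ≤_) (toℕ-inject₁ i)
    (lower (sub (inj₂ (inj₂ (cong suc (sym (toℕ-inject₁ i)))))))
  where
  lower : ∀ {k} → N[_] (P (suc m)) (suc j) k → toℕ j ≤ toℕ k
  lower (inj₁ refl)      = ℕ.n≤1+n _
  lower (inj₂ (inj₁ eq)) =
    subst (toℕ j ≤_) (sym eq) (ℕ.≤-trans (ℕ.n≤1+n _) (ℕ.n≤1+n _))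
  lower (inj₂ (inj₂ eq)) = ℕ.≤-reflexive (ℕ.suc-injective eq)

-- The end vertex 0 sees nothing beyond 1. For vertex 1 the witness is 2, which must exist since the
-- path on two vertices has twins; every later vertex is its own witness.
N[suc]⊈N[zero] : ∀ {k} (j : Fin (2 + k)) →
  ¬ (N[_] (P (3 + k)) (suc j) ⊆ N[_] (P (3 + k)) zero)
N[suc]⊈N[zero] zero sub with sub {suc (suc zero)} (inj₂ (inj₁ refl))
... | inj₂ (inj₁ ())
... | inj₂ (inj₂ ())
N[suc]⊈N[zero] (suc j) sub with sub {suc (suc j)} (inj₁ refl)
... | inj₂ (inj₁ ())
... | inj₂ (inj₂ ())

P-twinFree : ∀ {m} → 3 ≤ m → TwinFree (P m)
P-twinFree (s≤s (s≤s (s≤s z≤n))) = twinFree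
  where
  twinFree : ∀ {k} → TwinFree (P (3 + k))
  twinFree zero    zero    i≢j _       = i≢j refl
  twinFree zero    (suc j) _   (_ , g) = N[suc]⊈N[zero] j g
  twinFree (suc i) zero    _   (f , _) = N[suc]⊈N[zero] i f
  twinFree (suc i) (suc j) i≢j (f , g) = i≢j (cong suc (toℕ-injective
    (ℕ.≤-antisym (suc-N⊆⇒≤ j i g) (suc-N⊆⇒≤ i j f))))

-- The middle of each block of three dominates the block; a final block of one or two is dominated
-- by its first vertex, whence the rounding up.
every-third : ∀ m → Subset m
every-third 0                   = []
every-third 1                   = inside ∷ []
every-third 2                   = inside ∷ outside ∷ []
every-third (suc (suc (suc m))) = outside ∷ inside ∷ outside ∷ every-third m

∣every-third∣ : ∀ m → ∣ every-third m ∣ ≡ ⌈ m /3⌉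
∣every-third∣ 0                   = refl
∣every-third∣ 1                   = refl
∣every-third∣ 2                   = refl
∣every-third∣ (suc (suc (suc m))) =
  trans (cong suc (∣every-third∣ m)) (sym (m/n≡1+[m∸n]/n {3 + m + 2} (s≤s (s≤s (s≤s z≤n)))))

suc-N : ∀ {m} {i j : Fin m} → N[_] (P m) i j → N[_] (P (suc m)) (suc i) (suc j)
suc-N = Sum.map (cong suc) (Sum.map (cong suc) (cong suc))

every-third-dominating : ∀ m → Dominating (P m) (every-third m)
every-third-dominating 1 zero       = zero , inj₁ refl , here
every-third-dominating 2 zero       = zero , inj₁ refl , here
every-third-dominating 2 (suc zero) = zero , inj₂ (inj₂ refl) , here
every-third-dominating (suc (suc (suc m))) zero =
  suc zero , inj₂ (inj₁ refl) , there here
every-third-dominating (suc (suc (suc m))) (suc zero) =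
  suc zero , inj₁ refl , there here
every-third-dominating (suc (suc (suc m))) (suc (suc zero)) =
  suc zero , inj₂ (inj₂ refl) , there here
every-third-dominating (suc (suc (suc m))) (suc (suc (suc i)))
  with j , i~j , j∈S ← every-third-dominating m i =
  suc (suc (suc j)) , suc-N (suc-N (suc-N i~j)) , there (there (there j∈S))

-- The sizes `k` and `l` are variables so that matching on `refl` replaces them by the cardinalities
-- of `C` and `D`; they are later instantiated to `γID` and `γ`.
□P-bounds : (G : Graph) → TwinFree G → ∀ {m k l} → 3 ≤ m →
  (∃[ C ] IdentifyingCode G C × ∣ C ∣ ≡ k) → (∃[ D ] Dominating G D × ∣ D ∣ ≡ l) →
  Σ[ tf′ ∈ TwinFree (G □ P m) ]
    γID (G □ P m) tf′ ≤ (m * k) ⊓ (m * l + ⌈ m /3⌉ * (order G ∸ l))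
□P-bounds G tf {m} 3≤m (C , C-id , refl) (D , D-dom , refl) =
  tf′ , ℕ.⊓-glb
    (ℕ.≤-trans (γID≤ (G □ P m) tf′ code₁) (ℕ.≤-reflexive size₁))
    (ℕ.≤-trans (γID≤ (G □ P m) tf′ code₂) (ℕ.≤-reflexive size₂))
  where
  S = every-third m

  code₁ : IdentifyingCode (G □ P m) (cross C ⊥)
  code₁ = cross-identifying G (P m) C ⊥ (P-twinFree 3≤m) (proj₁ C-id) (inj₁ C-id)

  code₂ : IdentifyingCode (G □ P m) (cross D S)
  code₂ = cross-identifying G (P m) D S (P-twinFree 3≤m) D-dom
    (inj₂ (tf , every-third-dominating m))

  tf′ : TwinFree (G □ P m)
  tf′ = identifying⇒twinFree (G □ P m) code₁

  size₁ : ∣ cross C (⊥ {m}) ∣ ≡ m * ∣ C ∣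
  size₁ = begin
    ∣ cross C (⊥ {m}) ∣                        ≡⟨ ∣cross∣ C ⊥ ⟩
    m * ∣ C ∣ + ∣ ⊥ {m} ∣ * (order G ∸ ∣ C ∣)  ≡⟨ cong (λ s → m * ∣ C ∣ + s * _) (∣⊥∣≡0 m) ⟩
    m * ∣ C ∣ + 0                              ≡⟨ ℕ.+-identityʳ _ ⟩
    m * ∣ C ∣                                  ∎
    where open ≡-Reasoning

  size₂ : ∣ cross D S ∣ ≡ m * ∣ D ∣ + ⌈ m /3⌉ * (order G ∸ ∣ D ∣)
  size₂ = trans (∣cross∣ D S) (cong (λ s → m * ∣ D ∣ + s * _) (∣every-third∣ m))

theorem17 : (G : Graph) (tf : TwinFree G) (m : ℕ) → 3 ≤ m →
    Σ[ tf′ ∈ TwinFree (G □ P m) ]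
    γID (G □ P m) tf′ ≤ (m * γID G tf) ⊓ (m * γ G + ⌈ m /3⌉ * (order G ∸ γ G))
theorem17 G tf m 3≤m =
  □P-bounds G tf 3≤m (proj₁ (proj₂ (γID-min G tf))) (proj₁ (proj₂ (γ-min G)))
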